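{- The complexes $(\mathcal M_\bullet,\partial_{\mathrm{del}})$, $(\mathcal M_\bullet,\partial^{\mathrm{tot}}_{\mathrm{del}})$, $(\mathcal M_\bullet,\partial_{\mathrm{con}})$ and $(\mathcal M_\bullet,\partial^{\mathrm{tot}}_{\mathrm{con}})$ are all acyclic (have zero homology in every degree).
   Context: Matroids have finite ground set $E(\mathsf M)$, rank $\mathrm{rk}(\mathsf M)$ and nullity $\mathrm{nul}(\mathsf M)=|E(\mathsf M)|-\mathrm{rk}(\mathsf M)$; loops, coloops, deletion and contraction are standard. An orientation of $\mathsf M$ is a generator $\eta$ of $\bigwedge^{|E|}\mathbb{Z}\langle E\rangle$, $E=E(\mathsf M)$; the empty matroid $\varnothing$ has orientation $1$. A matroid isomorphism $\psi$ induces $\psi_*$ on top exterior powers. $\mathcal M$ is the $\mathbb{Q}$-vector space spanned by symbols $[\mathsf M,\eta]$ modulo $[\mathsf M,-\eta]=-[\mathsf M,\eta]$ and $[\mathsf M,\eta]=[\mathsf M',\psi_*\eta]$ for every isomorphism $\psi:\mathsf M\to\mathsf M'$; $\mathcal M_\bullet$ denotes $\mathcal M$ graded by ground-set size. With $\iota_x$ interior product ($\iota_x(x\wedge\alpha)=\alpha$): $\partial_{\mathrm{del}}[\mathsf M,\eta]=\sum_{x\text{ not a coloop}}[\mathsf M\setminus x,\iota_x\eta]$, $\partial_{\mathrm{clp}}$ the same sum over coloops, $\partial_{\mathrm{con}}[\mathsf M,\eta]=\sum_{x\text{ not a loop}}[\mathsf M/x,\iota_x\eta]$, $\partial_{\mathrm{lp}}$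 the same sum over loops, $\partial^{\mathrm{tot}}_{\mathrm{del}}=\partial_{\mathrm{del}}+\partial_{\mathrm{clp}}$, $\partial^{\mathrm{tot}}_{\mathrm{con}}=\partial_{\mathrm{lp}}+\partial_{\mathrm{con}}$; each lowers degree by one and squares to zero. -}

module Defs where

open import Data.Nat using (ℕ; zero; suc; _<ᵇ_)
open import Data.Nat.Base using (_%_)
open import Data.Bool using (Bool; true; false; _∧_; _∨_; not; if_then_else_; T)
open import Data.Bool.Properties using (T?)
open import Data.Fin using (Fin; toℕ; _<?_)
open import Data.Fin.Subset using (Subset; ⁅_⁆)
open import Data.Fin.Permutation using (Permutation′; _⟨$⟩ʳ_; _⟨$⟩ˡ_)
open import Data.Vec using (Vec; []; _∷_; lookup; tabulate; insertAt; _[_]≔_)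
open import Data.List using (List; []; _∷_; _++_; map; concatMap; allFin; foldr)
open import Data.Bool.ListAction using (all; any)
open import Data.Product using (Σ; _×_; _,_; proj₁; proj₂; ∃)
open import Data.Sign using (Sign) renaming (_*_ to _*ˢ_; opposite to opp)
import Data.Sign as S
open import Data.Rational using (ℚ; 0ℚ; 1ℚ; _+_; _*_; -_)
open import Data.Unit using (⊤)
open import Relation.Nullary using (does; yes; no)
open import Relation.Binary.PropositionalEquality using (_≡_)

------------------------------------------------------------------------
-- Finite sets and subsets.  Every finite ground set of size n is
-- identified with Fin n (with its standard order); a subset is a
-- characteristic vector (Data.Fin.Subset).

allSubsets : (n : ℕ) → List (Subset n)
allSubsets zero    = [] ∷ []
allSubsets (suc n) = map (false ∷_) (allSubsets n) ++ map (true ∷_) (allSubsets n)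

card : ∀ {n} → Subset n → ℕ
card []           = 0
card (true ∷ xs)  = suc (card xs)
card (false ∷ xs) = card xs

_⇒ᵇ_ : Bool → Bool → Bool
a ⇒ᵇ b = not a ∨ b

_==_ : Bool → Bool → Bool
true  == b = b
false == b = not b

_⊆ᵇ_ : ∀ {n} → Subset n → Subset n → Bool
_⊆ᵇ_ {n} A B = all (λ i → lookup A i ⇒ᵇ lookup B i) (allFin n)

emptySet : ∀ {n} → Subset n
emptySet = tabulate (λ _ → false)

------------------------------------------------------------------------
-- Matroids on Fin n, via the independence axioms (checked by finite
-- enumeration of all subsets, i.e. the Boolean form of the usual axioms):
--  (I1) ∅ is independent; (I2) subsets of independent sets are
--  independent; (I3) augmentation.

IndepSystem : ℕ → Set
IndepSystem n = Subset n → Bool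

isMatroid : ∀ {n} → IndepSystem n → Bool
isMatroid {n} I =
  I emptySet
  ∧ all (λ A → all (λ B → (I A ∧ (B ⊆ᵇ A)) ⇒ᵇ I B) (allSubsets n)) (allSubsets n)
  ∧ all (λ A → all (λ B →
        (I A ∧ I B ∧ (card A <ᵇ card B)) ⇒ᵇ
        any (λ y → lookup B y ∧ not (lookup A y) ∧ I (A [ y ]≔ true)) (allFin n))
      (allSubsets n)) (allSubsets n)

Matroid : ℕ → Set
Matroid n = Σ (IndepSystem n) (λ I → T (isMatroid I))

indep : ∀ {n} → Matroid n → IndepSystem n
indep = proj₁

-- loops, bases, coloops
isLoop : ∀ {n} → Matroid n → Fin n → Bool
isLoop M x = not (indep M ⁅ x ⁆)

isBasis : ∀ {n} → Matroid n → Subset n → Bool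
isBasis {n} M B = indep M B ∧ all (λ y → lookup B y ∨ not (indep M (B [ y ]≔ true))) (allFin n)

-- a coloop is an element contained in every basis
isColoop : ∀ {n} → Matroid n → Fin n → Bool
isColoop {n} M x = all (λ B → isBasis M B ⇒ᵇ lookup B x) (allSubsets n)

-- Deletion and contraction of x : Fin (suc n).  The ground set
-- Fin (suc n) ∖ {x} is identified with Fin n order-preservingly
-- (a subset S of Fin n corresponds to insertAt S x false).
deleteRaw : ∀ {n} → Matroid (suc n) → Fin (suc n) → IndepSystem n
deleteRaw M x S = indep M (insertAt S x false)

-- M / x : S independent iff S ∪ {x} independent (x not a loop);
-- for a loop x, M / x = M ∖ x.
contractRaw : ∀ {n} → Matroid (suc n) → Fin (suc n) → IndepSystem n
contractRaw M x S = if isLoop M x then indep M (insertAt S x false)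
                                  else indep M (insertAt S x true)

-- packaging as a matroid (the "nothing" branch never occurs: minors of
-- matroids are matroids; it only avoids carrying that proof here)
data Maybe′ (A : Set) : Set where
  nothing : Maybe′ A
  just    : A → Maybe′ A

toMatroid : ∀ {n} → IndepSystem n → Maybe′ (Matroid n)
toMatroid I with T? (isMatroid I)
... | yes p = just (I , p)
... | no  _ = nothing

------------------------------------------------------------------------
-- Orientations.  The top exterior power of ℤ⟨Fin n⟩ is generated by
-- η_n = e_0 ∧ … ∧ e_{n-1}; an orientation is s · η_n with s a sign.
-- A permutation σ acts by σ_* η_n = sgn(σ) η_n, sgn via inversions.
-- Interior product: ι_x η_{n+1} = (-1)^x η_n (after the order-preserving
-- identification of Fin (suc n) ∖ {x} with Fin n).

parity : ℕ → Sign
parity zero          = S.+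
parity (suc zero)    = S.-
parity (suc (suc k)) = parity k

countᵇ : ∀ {A : Set} → (A → Bool) → List A → ℕ
countᵇ p []       = 0
countᵇ p (a ∷ as) = if p a then suc (countᵇ p as) else countᵇ p as

-- number of pairs i < j with σ j < σ i
inversions : ∀ {n} → Permutation′ n → ℕ
inversions {n} σ =
  countᵇ (λ ij → does (proj₁ ij <? proj₂ ij) ∧ does ((σ ⟨$⟩ʳ proj₂ ij) <? (σ ⟨$⟩ʳ proj₁ ij)))
         (concatMap (λ i → map (λ j → (i , j)) (allFin n)) (allFin n))

sgn : ∀ {n} → Permutation′ n → Sign
sgn σ = parity (inversions σ)

-- image of a subset under a permutation
image : ∀ {n} → Permutation′ n → Subset n → Subset n
image σ S = tabulate (λ j → lookup S (σ ⟨$⟩ˡ j))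

IsIso : ∀ {n} → Permutation′ n → Matroid n → Matroid n → Set
IsIso {n} σ M M' = (S : Subset n) → indep M' (image σ S) ≡ indep M S

------------------------------------------------------------------------
-- The space 𝓜_n: generators [M, s·η_n]; formal ℚ-combinations as lists.

Gen : ℕ → Set
Gen n = Matroid n × Sign

FS : ℕ → Set
FS n = List (ℚ × Gen n)

signEq : Sign → Sign → Bool
signEq S.+ S.+ = true
signEq S.- S.- = true
signEq _   _   = false

genEq : ∀ {n} → Gen n → Gen n → Bool
genEq {n} (M , s) (M' , s') =
  signEq s s' ∧ all (λ S → indep M S == indep M' S) (allSubsets n)

-- coefficient of a generator in a formal combination
coeff : ∀ {n} → FS n → Gen n → ℚ
coeff xs g = foldr (λ ch acc → (if genEq (proj₂ ch) g then proj₁ ch else 0ℚ) + acc) 0ℚ xs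

scale : ∀ {n} → ℚ → FS n → FS n
scale c = map (λ dh → (c * proj₁ dh , proj₂ dh))

_−_ : ∀ {n} → FS n → FS n → FS n
x − y = x ++ scale (- 1ℚ) y

-- defining relations of 𝓜
data Rel (n : ℕ) : Set where
  antisym : Gen n → Rel n
  iso     : (M M' : Matroid n) (σ : Permutation′ n) → IsIso σ M M' → Sign → Rel n

relElem : ∀ {n} → Rel n → FS n
relElem (antisym (M , s))   = (1ℚ , (M , s)) ∷ (1ℚ , (M , opp s)) ∷ []
relElem (iso M M' σ _ s)    = (1ℚ , (M , s)) ∷ (- 1ℚ , (M' , sgn σ *ˢ s)) ∷ []

-- x represents 0 in 𝓜_n: x is a ℚ-combination of relations
IsZero : ∀ {n} → FS n → Set
IsZero {n} x = ∃ λ (rs : List (ℚ × Rel n)) →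
  (g : Gen n) → coeff x g ≡ coeff (concatMap (λ cr → scale (proj₁ cr) (relElem (proj₂ cr))) rs) g

------------------------------------------------------------------------
-- Differentials 𝓜_{n+1} → 𝓜_n

Minor : Set
Minor = ∀ {n} → Matroid (suc n) → Fin (suc n) → IndepSystem n

-- ∂[M, s η] = Σ_{x : keep M x} [minor M x, ι_x (s η)]
dGen : Minor → (∀ {n} → Matroid (suc n) → Fin (suc n) → Bool) →
       ∀ {n} → Gen (suc n) → FS n
dGen minor keep {n} (M , s) = concatMap term (allFin (suc n))
  where
  term : Fin (suc n) → FS n
  term x with keep M x | toMatroid (minor M x)
  ... | true  | just M' = (1ℚ , (M' , parity (toℕ x) *ˢ s)) ∷ []
  ... | _     | _       = []

diff : Minor → (∀ {n} → Matroid (suc n) → Fin (suc n) → Bool) →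
       ∀ {n} → FS (suc n) → FS n
diff minor keep xs = concatMap (λ cg → scale (proj₁ cg) (dGen minor keep (proj₂ cg))) xs

Differential : Set
Differential = ∀ {n} → FS (suc n) → FS n

∂del ∂totdel ∂con ∂totcon : Differential
∂del    = diff deleteRaw   (λ M x → not (isColoop M x))
∂totdel = diff deleteRaw   (λ _ _ → true)
∂con    = diff contractRaw (λ M x → not (isLoop M x))
∂totcon = diff contractRaw (λ _ _ → true)

-- cycles of (𝓜_•, ∂) in degree n (in degree 0 every element is a cycle)
IsCycle : Differential → (n : ℕ) → FS n → Set
IsCycle d zero    x = ⊤
IsCycle d (suc n) x = IsZero (d x)

-- zero homology in every degree: every cycle is a boundary (in 𝓜_n)
Acyclic : Differential → Set
Acyclic d = (n : ℕ) (x : FS n) → IsCycle d n x →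
            ∃ λ (y : FS (suc n)) → IsZero (d y − x)

{-# OPTIONS --safe #-}

-- Adjoin to every matroid a new element 0: a loop for the two deletion complexes, a coloop for
-- the two contraction complexes.  Isomorphisms extend by fixing 0, with the same sign, so this
-- induces a map h : 𝓜_n → 𝓜_{n+1}.  In ∂(h[M, η]) the term of the new element is [M, η]:
-- deleting a loop or contracting a coloop gives back M, and a loop is never a coloop nor a
-- coloop a loop.  For an old element x, both the minor and the loop/coloop condition commute
-- with adjoining 0, while ι_{x+1} = −ι_x; so these terms add up to −h(∂[M, η]).  Hence
-- ∂h + h∂ = id, and every cycle z is the boundary of h z.

module Submission where

open import Defs
open import Data.Bool using (Bool; true; false; _∧_; _∨_; not; T; if_then_else_)
open import Data.Bool.ListAction using (all; any; and)
open import Data.Bool.Properties using (T-∧; T-≡; T?; T-irrelevant)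
open import Data.Empty using (⊥-elim)
open import Data.Fin using (Fin; zero; suc; toℕ; _<?_)
open import Data.Fin.Permutation using (Permutation′; _⟨$⟩ʳ_; lift₀)
open import Data.Fin.Properties using (¬∀⟶∃¬)
open import Data.Fin.Subset using (Subset; ⊥)
import Data.List as L
open import Data.List using (List; []; _∷_; _++_; map; concatMap; allFin)
open import Data.List.Membership.Propositional using (_∈_; lose)
open import Data.List.Membership.Propositional.Properties using (∈-map⁺; ∈-++⁺ˡ; ∈-++⁺ʳ; ∈-allFin)
open import Data.List.Properties
  using (map-++; map-∘; ++-identityʳ; concatMap-++; concatMap-map; concatMap-cong; map-concatMap; map-tabulate)
open import Data.List.Relation.Unary.All as All using (All)
open import Data.List.Relation.Unary.All.Properties using (all⁺; all⁻)
open import Data.List.Relation.Unary.Any using (here; satisfied)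
open import Data.List.Relation.Unary.Any.Properties using (any⁺; any⁻)
open import Data.Nat as ℕ using (ℕ; zero; suc)
import Data.Nat.Properties as ℕ
open import Data.Product using (_×_; _,_; ∃; proj₁; proj₂; map₂)
open import Data.Rational using (ℚ; 0ℚ; 1ℚ; _+_; _*_; -_)
import Data.Rational.Properties as ℚ
open import Data.Rational.Solver using (module +-*-Solver)
open import Data.Sign as Sign using (Sign) renaming (_*_ to _*ˢ_)
open import Data.Sign.Properties using (opposite-involutive)
open import Data.Unit using (tt)
open import Data.Vec using ([]; _∷_; lookup; _[_]≔_)
open import Function.Base using (_∘_; id)
open import Function.Bundles using (_⇔_; mk⇔; Equivalence)
open import Level using (0ℓ)
open import Relation.Binary.Bundles using (Setoid)
open import Relation.Binary.PropositionalEquality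
  using (_≡_; refl; sym; trans; cong; cong₂; subst; module ≡-Reasoning)
import Relation.Binary.Reasoning.Setoid as SetoidReasoning
open import Relation.Nullary using (¬_; Dec; yes; no; does)

open Equivalence using (to; from)

-- Boolean reflection

T-injective : ∀ {a b} → (T a → T b) → (T b → T a) → a ≡ b
T-injective {true}  {true}  _ _ = refl
T-injective {true}  {false} f _ = ⊥-elim (f tt)
T-injective {false} {true}  _ g = ⊥-elim (g tt)
T-injective {false} {false} _ _ = refl

T-⇒ᵇ : ∀ {a b} → T (a ⇒ᵇ b) ⇔ (T a → T b)
T-⇒ᵇ {true}  = mk⇔ (λ t _ → t) (λ f → f tt)
T-⇒ᵇ {false} = mk⇔ (λ _ ()) (λ _ → tt)

T-== : ∀ {a b} → T (a == b) ⇔ a ≡ b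
T-== {true}  {true}  = mk⇔ (λ _ → refl) (λ _ → tt)
T-== {true}  {false} = mk⇔ (λ ()) (λ ())
T-== {false} {true}  = mk⇔ (λ ()) (λ ())
T-== {false} {false} = mk⇔ (λ _ → refl) (λ _ → tt)

T-all-complete : ∀ {A : Set} {p : A → Bool} {xs : List A} → (∀ x → x ∈ xs) →
                 T (all p xs) ⇔ (∀ x → T (p x))
T-all-complete {p = p} {xs} complete =
  mk⇔ (λ t x → All.lookup (all⁺ p xs t) (complete x)) (λ f → all⁻ p {xs} (All.tabulate (λ {x} _ → f x)))

T-any-complete : ∀ {A : Set} {p : A → Bool} {xs : List A} → (∀ x → x ∈ xs) →
                 T (any p xs) ⇔ ∃ λ x → T (p x)
T-any-complete {p = p} {xs} complete =
  mk⇔ (λ t → satisfied (any⁻ p xs t)) (λ (x , px) → any⁺ p (lose (complete x) px))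

∈-allSubsets : ∀ {n} (S : Subset n) → S ∈ allSubsets n
∈-allSubsets []          = here refl
∈-allSubsets (false ∷ S) = ∈-++⁺ˡ (∈-map⁺ (false ∷_) (∈-allSubsets S))
∈-allSubsets {suc n} (true ∷ S) =
  ∈-++⁺ʳ (map (false ∷_) (allSubsets n)) (∈-map⁺ (true ∷_) (∈-allSubsets S))

T-all-allSubsets : ∀ {n} {p : Subset n → Bool} → T (all p (allSubsets n)) ⇔ (∀ S → T (p S))
T-all-allSubsets = T-all-complete ∈-allSubsets

T-all-allFin : ∀ {n} {p : Fin n → Bool} → T (all p (allFin n)) ⇔ (∀ i → T (p i))
T-all-allFin = T-all-complete ∈-allFin

T-any-allFin : ∀ {n} {p : Fin n → Bool} → T (any p (allFin n)) ⇔ ∃ λ i → T (p i)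
T-any-allFin = T-any-complete ∈-allFin

-- Matroid axioms

T-⊆ᵇ : ∀ {n} {A B : Subset n} → T (B ⊆ᵇ A) ⇔ (∀ i → T (lookup B i) → T (lookup A i))
T-⊆ᵇ = mk⇔ (λ t i → to T-⇒ᵇ (to T-all-allFin t i))
           (λ f → from T-all-allFin (λ i → from T-⇒ᵇ (f i)))

module _ {n} (I : IndepSystem n) where

  Hereditary : Set
  Hereditary = ∀ A B → T (I A) → (∀ i → T (lookup B i) → T (lookup A i)) → T (I B)

  Augmentation : Set
  Augmentation = ∀ A B → T (I A) → T (I B) → card A ℕ.< card B →
                 ∃ λ y → T (lookup B y) × T (not (lookup A y)) × T (I (A [ y ]≔ true))

  hereditaryᵇ augmentationᵇ : Bool
  hereditaryᵇ = all (λ A → all (λ B → (I A ∧ (B ⊆ᵇ A)) ⇒ᵇ I B) (allSubsets n)) (allSubsets n)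
  augmentationᵇ = all (λ A → all (λ B →
        (I A ∧ I B ∧ (card A ℕ.<ᵇ card B)) ⇒ᵇ
        any (λ y → lookup B y ∧ not (lookup A y) ∧ I (A [ y ]≔ true)) (allFin n))
      (allSubsets n)) (allSubsets n)

  T-hereditaryᵇ : T hereditaryᵇ ⇔ Hereditary
  T-hereditaryᵇ = mk⇔
    (λ t A B iA B⊆A → to T-⇒ᵇ (to T-all-allSubsets (to T-all-allSubsets t A) B)
                               (from T-∧ (iA , from (T-⊆ᵇ {A = A} {B}) B⊆A)))
    (λ hered → from T-all-allSubsets λ A → from T-all-allSubsets λ B → from T-⇒ᵇ λ t →
       let (iA , B⊆A) = to (T-∧ {I A}) t in hered A B iA (to (T-⊆ᵇ {A = A} {B}) B⊆A))

  T-augmentationᵇ : T augmentationᵇ ⇔ Augmentation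
  T-augmentationᵇ = mk⇔
    (λ t A B iA iB A<B →
       let (y , Ay) = to T-any-allFin (to T-⇒ᵇ (to T-all-allSubsets (to T-all-allSubsets t A) B)
                                         (from T-∧ (iA , from T-∧ (iB , ℕ.<⇒<ᵇ A<B))))
           (By , rest) = to (T-∧ {lookup B y}) Ay
       in y , By , to T-∧ rest)
    (λ aug → from T-all-allSubsets λ A → from T-all-allSubsets λ B → from T-⇒ᵇ λ t →
       let (iA , rest) = to (T-∧ {I A}) t
           (iB , A<B)  = to (T-∧ {I B}) rest
           (y , By , ¬Ay , iAy) = aug A B iA iB (ℕ.<ᵇ⇒< _ _ A<B)
       in from T-any-allFin (y , from T-∧ (By , from T-∧ (¬Ay , iAy))))

  record IsMatroid : Set where
    field
      indep-∅      : T (I emptySet)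
      hereditary   : Hereditary
      augmentation : Augmentation

  isMatroid⇔IsMatroid : T (isMatroid I) ⇔ IsMatroid
  isMatroid⇔IsMatroid = mk⇔
    (λ t → let (e , rest) = to (T-∧ {I emptySet}) t
               (h , a)    = to (T-∧ {hereditaryᵇ}) rest
           in record { indep-∅ = e ; hereditary = to T-hereditaryᵇ h ; augmentation = to T-augmentationᵇ a })
    (λ m → let open IsMatroid m in
           from T-∧ (indep-∅ , from T-∧ (from T-hereditaryᵇ hereditary , from T-augmentationᵇ augmentation)))

-- Adjoining a loop or a coloop

-- The new element 0 is a loop if κ = false and a coloop if κ = true.
adjoin : ∀ {n} → Bool → IndepSystem n → IndepSystem (suc n)
adjoin κ I (false ∷ S) = I S
adjoin κ I (true ∷ S)  = κ ∧ I S

deleteZero : ∀ {n} → IndepSystem (suc n) → IndepSystem n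
deleteZero I S = I (false ∷ S)

module _ {n} (κ : Bool) {I : IndepSystem n} where

  private
    drop : ∀ a {S} → T (adjoin κ I (a ∷ S)) → T (I S)
    drop false i = i
    drop true  i = proj₂ (to (T-∧ {κ}) i)

    κ-of : ∀ {S} → T (adjoin κ I (true ∷ S)) → T κ
    κ-of i = proj₁ (to T-∧ i)

  IsMatroid-adjoin : IsMatroid I → IsMatroid (adjoin κ I)
  IsMatroid-adjoin m = record
    { indep-∅ = indep-∅ ; hereditary = hered ; augmentation = augment }
    where
    open IsMatroid m
    hered : Hereditary (adjoin κ I)
    hered (a ∷ A) (false ∷ B) iA B⊆A = hereditary A B (drop a iA) (λ i → B⊆A (suc i))
    hered (false ∷ A) (true ∷ B) iA B⊆A = ⊥-elim (B⊆A zero tt)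
    hered (true ∷ A)  (true ∷ B) iA B⊆A =
      from T-∧ (κ-of iA , hereditary A B (drop true iA) (λ i → B⊆A (suc i)))
    augment : Augmentation (adjoin κ I)
    augment (false ∷ A) (false ∷ B) iA iB A<B =
      let (y , By , ¬Ay , iAy) = augmentation A B iA iB A<B in suc y , By , ¬Ay , iAy
    augment (false ∷ A) (true ∷ B) iA iB A<B = zero , tt , tt , from T-∧ (κ-of iB , iA)
    augment (true ∷ A) (false ∷ B) iA iB A<B =
      let (y , By , ¬Ay , iAy) = augmentation A B (drop true iA) iB (ℕ.<-trans (ℕ.n<1+n _) A<B)
      in suc y , By , ¬Ay , from T-∧ (κ-of iA , iAy)
    augment (true ∷ A) (true ∷ B) iA iB A<B =
      let (y , By , ¬Ay , iAy) = augmentation A B (drop true iA) (drop true iB) (ℕ.s<s⁻¹ A<B)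
      in suc y , By , ¬Ay , from T-∧ (κ-of iA , iAy)

IsMatroid-deleteZero : ∀ {n} {I : IndepSystem (suc n)} → IsMatroid I → IsMatroid (deleteZero I)
IsMatroid-deleteZero {I = I} m = record
  { indep-∅ = indep-∅ ; hereditary = hered ; augmentation = augment }
  where
  open IsMatroid m
  hered : Hereditary (deleteZero I)
  hered A B iA B⊆A = hereditary (false ∷ A) (false ∷ B) iA λ { zero () ; (suc i) → B⊆A i }
  augment : Augmentation (deleteZero I)
  augment A B iA iB A<B with augmentation (false ∷ A) (false ∷ B) iA iB A<B
  ... | suc y , By , ¬Ay , iAy = y , By , ¬Ay , iAy

IsMatroid-resp : ∀ {n} {I J : IndepSystem n} → (∀ S → I S ≡ J S) → IsMatroid I → IsMatroid J
IsMatroid-resp {I = I} {J} I≗J m = record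
  { indep-∅      = I⇒J indep-∅
  ; hereditary   = λ A B iA B⊆A → I⇒J (hereditary A B (J⇒I iA) B⊆A)
  ; augmentation = λ A B iA iB A<B →
      let (y , By , ¬Ay , iAy) = augmentation A B (J⇒I iA) (J⇒I iB) A<B in y , By , ¬Ay , I⇒J iAy
  }
  where
  open IsMatroid m
  I⇒J : ∀ {S} → T (I S) → T (J S)
  I⇒J {S} = subst T (I≗J S)
  J⇒I : ∀ {S} → T (J S) → T (I S)
  J⇒I {S} = subst T (sym (I≗J S))

-- abstract: unfolding these proofs during conversion checking is prohibitively expensive
abstract
  isMatroid-adjoin : ∀ {n} κ {I : IndepSystem n} → T (isMatroid I) → T (isMatroid (adjoin κ I))
  isMatroid-adjoin κ {I} = from (isMatroid⇔IsMatroid _) ∘ IsMatroid-adjoin κ ∘ to (isMatroid⇔IsMatroid I)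

  isMatroid-deleteZero : ∀ {n} {I : IndepSystem (suc n)} → T (isMatroid I) → T (isMatroid (deleteZero I))
  isMatroid-deleteZero {I = I} = from (isMatroid⇔IsMatroid _) ∘ IsMatroid-deleteZero ∘ to (isMatroid⇔IsMatroid I)

  isMatroid-resp : ∀ {n} {I J : IndepSystem n} → (∀ S → I S ≡ J S) → T (isMatroid I) → T (isMatroid J)
  isMatroid-resp {I = I} I≗J = from (isMatroid⇔IsMatroid _) ∘ IsMatroid-resp I≗J ∘ to (isMatroid⇔IsMatroid I)

IsMatroid-indep : ∀ {n} (M : Matroid n) → IsMatroid (indep M)
IsMatroid-indep M = to (isMatroid⇔IsMatroid (indep M)) (proj₂ M)

adjoinM : ∀ {n} → Bool → Matroid n → Matroid (suc n)
adjoinM κ (I , p) = adjoin κ I , isMatroid-adjoin κ {I} p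

deleteZeroM : ∀ {n} → Matroid (suc n) → Matroid n
deleteZeroM (I , p) = deleteZero I , isMatroid-deleteZero {I = I} p

toMatroid-just : ∀ {n} {I : IndepSystem n} (p : T (isMatroid I)) → toMatroid I ≡ just (I , p)
toMatroid-just {I = I} p with T? (isMatroid I)
... | yes q = cong (λ q → just (I , q)) (T-irrelevant q p)
... | no ¬p = ⊥-elim (¬p p)

toMatroid-nothing : ∀ {n} {I : IndepSystem n} → ¬ T (isMatroid I) → toMatroid I ≡ nothing
toMatroid-nothing {I = I} ¬p with T? (isMatroid I)
... | yes p = ⊥-elim (¬p p)
... | no _  = refl

-- Generators and formal sums

infix 4 _≅_

-- A record rather than a Σ-type (likewise _≈_ below), so that its indices can be inferred.
record _≅_ {n} (g h : Gen n) : Set where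
  constructor _,_
  field
    sign-≡  : proj₂ g ≡ proj₂ h
    indep-≗ : ∀ S → indep (proj₁ g) S ≡ indep (proj₁ h) S

≅-sym : ∀ {n} {g h : Gen n} → g ≅ h → h ≅ g
≅-sym (s≡t , M≗N) = sym s≡t , λ S → sym (M≗N S)

≅-trans : ∀ {n} {f g h : Gen n} → f ≅ g → g ≅ h → f ≅ h
≅-trans (r≡s , L≗M) (s≡t , M≗N) = trans r≡s s≡t , λ S → trans (L≗M S) (M≗N S)

T-signEq : ∀ {s t} → T (signEq s t) ⇔ s ≡ t
T-signEq {Sign.+} {Sign.+} = mk⇔ (λ _ → refl) (λ _ → tt)
T-signEq {Sign.+} {Sign.-} = mk⇔ (λ ()) (λ ())
T-signEq {Sign.-} {Sign.+} = mk⇔ (λ ()) (λ ())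
T-signEq {Sign.-} {Sign.-} = mk⇔ (λ _ → refl) (λ _ → tt)

T-genEq : ∀ {n} {g h : Gen n} → T (genEq g h) ⇔ g ≅ h
T-genEq {g = M , s} {N , t} = mk⇔
  (λ e → let (s≡t , M≗N) = to (T-∧ {signEq s t}) e
         in to T-signEq s≡t , λ S → to T-== (to T-all-allSubsets M≗N S))
  (λ (s≡t , M≗N) → from T-∧ (from T-signEq s≡t , from T-all-allSubsets λ S → from T-== (M≗N S)))

genEq-resp : ∀ {n} {g h : Gen n} → g ≅ h → ∀ G → genEq g G ≡ genEq h G
genEq-resp {g = g} {h} g≅h G = T-injective
  (λ e → from T-genEq (≅-trans (≅-sym g≅h) (to (T-genEq {g = g} {G}) e)))
  (λ e → from T-genEq (≅-trans g≅h (to (T-genEq {g = h} {G}) e)))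

infix 4 _≈_
infix 6 _•_

record _≈_ {n} (x y : FS n) : Set where
  constructor mk≈
  field coeff≡ : ∀ g → coeff x g ≡ coeff y g

open _≈_

≈-refl : ∀ {n} {x : FS n} → x ≈ x
≈-refl = mk≈ λ _ → refl

≈-sym : ∀ {n} {x y : FS n} → x ≈ y → y ≈ x
≈-sym x≈y = mk≈ λ g → sym (coeff≡ x≈y g)

≈-trans : ∀ {n} {x y z : FS n} → x ≈ y → y ≈ z → x ≈ z
≈-trans x≈y y≈z = mk≈ λ g → trans (coeff≡ x≈y g) (coeff≡ y≈z g)

≈-setoid : ℕ → Setoid 0ℓ 0ℓ
≈-setoid n = record
  { Carrier       = FS n
  ; _≈_           = _≈_
  ; isEquivalence = record { refl = ≈-refl ; sym = ≈-sym ; trans = ≈-trans }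
  }

≡⇒≈ : ∀ {n} {x y : FS n} → x ≡ y → x ≈ y
≡⇒≈ refl = mk≈ λ _ → refl

_•_ : ∀ {n} → ℚ → Gen n → FS n
c • g = (c , g) ∷ []

coeff-++ : ∀ {n} (x y : FS n) g → coeff (x ++ y) g ≡ coeff x g + coeff y g
coeff-++ []            y g = sym (ℚ.+-identityˡ _)
coeff-++ ((c , h) ∷ x) y g =
  trans (cong ((if genEq h g then c else 0ℚ) +_) (coeff-++ x y g))
        (sym (ℚ.+-assoc (if genEq h g then c else 0ℚ) _ _))

coeff-scale : ∀ {n} c (x : FS n) g → coeff (scale c x) g ≡ c * coeff x g
coeff-scale c []            g = sym (ℚ.*-zeroʳ c)
coeff-scale c ((q , h) ∷ x) g with genEq h g
... | true  = trans (cong (c * q +_) (coeff-scale c x g)) (sym (ℚ.*-distribˡ-+ c q _))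
... | false = trans (ℚ.+-identityˡ _)
                (trans (coeff-scale c x g) (cong (c *_) (sym (ℚ.+-identityˡ _))))

++-cong : ∀ {n} {x x′ y y′ : FS n} → x ≈ x′ → y ≈ y′ → x ++ y ≈ x′ ++ y′
++-cong {x = x} {x′} {y} {y′} x≈x′ y≈y′ = mk≈ λ g →
  trans (coeff-++ x y g) (trans (cong₂ _+_ (coeff≡ x≈x′ g) (coeff≡ y≈y′ g)) (sym (coeff-++ x′ y′ g)))

++-interchange : ∀ {n} (w x y z : FS n) → (w ++ x) ++ (y ++ z) ≈ (w ++ y) ++ (x ++ z)
++-interchange w x y z = mk≈ λ g → begin
  coeff ((w ++ x) ++ (y ++ z)) g                      ≡⟨ coeff-++ (w ++ x) (y ++ z) g ⟩
  coeff (w ++ x) g + coeff (y ++ z) g                 ≡⟨ cong₂ _+_ (coeff-++ w x g) (coeff-++ y z g) ⟩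
  (coeff w g + coeff x g) + (coeff y g + coeff z g)   ≡⟨ interchange (coeff w g) (coeff x g) (coeff y g) (coeff z g) ⟩
  (coeff w g + coeff y g) + (coeff x g + coeff z g)   ≡⟨ cong₂ _+_ (coeff-++ w y g) (coeff-++ x z g) ⟨
  coeff (w ++ y) g + coeff (x ++ z) g                 ≡⟨ coeff-++ (w ++ y) (x ++ z) g ⟨
  coeff ((w ++ y) ++ (x ++ z)) g                      ∎
  where
  open ≡-Reasoning
  open +-*-Solver
  interchange : ∀ a b c d → (a + b) + (c + d) ≡ (a + c) + (b + d)
  interchange = solve 4 (λ a b c d → (a :+ b) :+ (c :+ d) := (a :+ c) :+ (b :+ d)) refl

++-comm : ∀ {n} (x y : FS n) → x ++ y ≈ y ++ x
++-comm x y = mk≈ λ g →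
  trans (coeff-++ x y g) (trans (ℚ.+-comm (coeff x g) (coeff y g)) (sym (coeff-++ y x g)))

scale-++ : ∀ {n} c (x y : FS n) → scale c (x ++ y) ≡ scale c x ++ scale c y
scale-++ c = map-++ _

scale-scale : ∀ {n} c q (x : FS n) → scale c (scale q x) ≡ scale (c * q) x
scale-scale c q []            = refl
scale-scale c q ((r , g) ∷ x) = cong₂ _∷_ (cong (_, g) (sym (ℚ.*-assoc c q r))) (scale-scale c q x)

scale-1 : ∀ {n} (x : FS n) → scale 1ℚ x ≡ x
scale-1 []            = refl
scale-1 ((q , g) ∷ x) = cong₂ _∷_ (cong (_, g) (ℚ.*-identityˡ q)) (scale-1 x)

•-resp-≅ : ∀ {n} c {g h : Gen n} → g ≅ h → c • g ≈ c • h
•-resp-≅ c g≅h = mk≈ λ G → cong (λ b → (if b then c else 0ℚ) + 0ℚ) (genEq-resp g≅h G)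

•-cancel : ∀ {n} (g : Gen n) → 1ℚ • g ++ (- 1ℚ) • g ≈ []
•-cancel g = mk≈ cancel
  where
  cancel : ∀ G → coeff (1ℚ • g ++ (- 1ℚ) • g) G ≡ 0ℚ
  cancel G with genEq g G
  ... | true  = refl
  ... | false = refl

linear : ∀ {A : Set} {n} → (A → FS n) → List (ℚ × A) → FS n
linear F = concatMap (λ qa → scale (proj₁ qa) (F (proj₂ qa)))

linear-++ : ∀ {A : Set} {n} (F : A → FS n) xs ys → linear F (xs ++ ys) ≡ linear F xs ++ linear F ys
linear-++ F = concatMap-++ _

linear-scale : ∀ {A : Set} {n} c (F : A → FS n) xs →
               scale c (linear F xs) ≡ linear F (map (λ (q , a) → (c * q , a)) xs)
linear-scale c F []             = refl
linear-scale c F ((q , a) ∷ xs) = begin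
  scale c (scale q (F a) ++ linear F xs)          ≡⟨ scale-++ c (scale q (F a)) _ ⟩
  scale c (scale q (F a)) ++ scale c (linear F xs) ≡⟨ cong₂ _++_ (scale-scale c q (F a)) (linear-scale c F xs) ⟩
  scale (c * q) (F a) ++ linear F (map (λ (q , a) → (c * q , a)) xs) ∎
  where open ≡-Reasoning

linear-cong : ∀ {A : Set} {n} {F G : A → FS n} → (∀ a → F a ≡ G a) → ∀ xs → linear F xs ≡ linear G xs
linear-cong F≗G = concatMap-cong (λ (q , a) → cong (scale q) (F≗G a))

linear-map₂ : ∀ {A B : Set} {n} (F : B → FS n) (f : A → B) xs → linear F (map (map₂ f) xs) ≡ linear (F ∘ f) xs
linear-map₂ F f = concatMap-map _ (map₂ f)

map₂-linear : ∀ {A : Set} {m n} (φ : Gen m → Gen n) (F : A → FS m) xs →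
              map (map₂ φ) (linear F xs) ≡ linear (map (map₂ φ) ∘ F) xs
map₂-linear φ F xs =
  trans (map-concatMap (map₂ φ) _ xs) (concatMap-cong (λ (q , a) → trans (sym (map-∘ (F a))) (map-∘ (F a))) xs)

concatMap-merge : ∀ {A : Set} {n} (f g : A → FS n) xs →
                  concatMap f xs ++ concatMap g xs ≈ concatMap (λ a → f a ++ g a) xs
concatMap-merge f g []       = ≈-refl
concatMap-merge f g (a ∷ xs) = ≈-trans (++-interchange (f a) _ (g a) _) (++-cong ≈-refl (concatMap-merge f g xs))

linear-merge : ∀ {A : Set} {n} (F G : A → FS n) xs → linear F xs ++ linear G xs ≈ linear (λ a → F a ++ G a) xs
linear-merge F G xs = ≈-trans (concatMap-merge _ _ xs)
  (≡⇒≈ (concatMap-cong (λ (q , a) → sym (scale-++ q (F a) (G a))) xs))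

scale-linear : ∀ {n} c (x : FS n) → scale c x ≡ linear (c •_) x
scale-linear c []            = refl
scale-linear c ((q , g) ∷ x) = cong₂ _∷_ (cong (_, g) (ℚ.*-comm c q)) (scale-linear c x)

-- The relations of 𝓜

-- IsZero x is, up to the record wrapper of _≈_, ∃ λ rs → x ≈ linear relElem rs.
IsZero-[] : ∀ {n} → IsZero {n} []
IsZero-[] = [] , λ _ → refl

IsZero-resp : ∀ {n} {x y : FS n} → x ≈ y → IsZero x → IsZero y
IsZero-resp x≈y (rs , x≈rs) = rs , λ g → trans (sym (coeff≡ x≈y g)) (x≈rs g)

IsZero-++ : ∀ {n} {x y : FS n} → IsZero x → IsZero y → IsZero (x ++ y)
IsZero-++ {x = x} {y} (rs , x≈rs) (ss , y≈ss) =
  rs ++ ss , λ g → trans (coeff≡ (++-cong x≈ y≈) g) (cong (λ z → coeff z g) (sym (linear-++ relElem rs ss)))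
  where
  x≈ = mk≈ {x = x} {linear relElem rs} x≈rs
  y≈ = mk≈ {x = y} {linear relElem ss} y≈ss

IsZero-scale : ∀ {n} c {x : FS n} → IsZero x → IsZero (scale c x)
IsZero-scale c {x} (rs , x≈rs) = c·rs , λ g → begin
  coeff (scale c x) g                   ≡⟨ coeff-scale c x g ⟩
  c * coeff x g                         ≡⟨ cong (c *_) (x≈rs g) ⟩
  c * coeff (linear relElem rs) g       ≡⟨ coeff-scale c (linear relElem rs) g ⟨
  coeff (scale c (linear relElem rs)) g ≡⟨ cong (λ z → coeff z g) (linear-scale c relElem rs) ⟩
  coeff (linear relElem c·rs) g         ∎
  where
  open ≡-Reasoning
  c·rs = map (λ (q , r) → (c * q , r)) rs

IsZero-relElem : ∀ {n} (r : Rel n) → IsZero (relElem r)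
IsZero-relElem r = (1ℚ , r) ∷ [] , coeff≡ (≡⇒≈ (sym (trans (++-identityʳ _) (scale-1 (relElem r)))))

IsZero-concatMap : ∀ {A : Set} {n} {f : A → FS n} → (∀ a → IsZero (f a)) → ∀ xs → IsZero (concatMap f xs)
IsZero-concatMap f-zero []       = IsZero-[]
IsZero-concatMap {f = f} f-zero (a ∷ xs) = IsZero-++ {x = f a} (f-zero a) (IsZero-concatMap f-zero xs)

IsZero-linear : ∀ {A : Set} {n} {F : A → FS n} → (∀ a → IsZero (F a)) → ∀ xs → IsZero (linear F xs)
IsZero-linear {F = F} F-zero = IsZero-concatMap (λ (q , a) → IsZero-scale q {F a} (F-zero a))

-- Contracting homotopies

cancel-middle : ∀ {n} (a b c : FS n) → (a ++ (b ++ c)) ++ scale (- 1ℚ) b ≈ a ++ c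
cancel-middle a b c = mk≈ λ g → begin
  coeff ((a ++ (b ++ c)) ++ scale (- 1ℚ) b) g
    ≡⟨ coeff-++ (a ++ (b ++ c)) _ g ⟩
  coeff (a ++ (b ++ c)) g + coeff (scale (- 1ℚ) b) g
    ≡⟨ cong₂ _+_ (trans (coeff-++ a (b ++ c) g) (cong (coeff a g +_) (coeff-++ b c g))) (coeff-scale (- 1ℚ) b g) ⟩
  (coeff a g + (coeff b g + coeff c g)) + - 1ℚ * coeff b g
    ≡⟨ solve 3 (λ a b c → (a :+ (b :+ c)) :+ con (- 1ℚ) :* b := a :+ c) refl (coeff a g) (coeff b g) (coeff c g) ⟩
  coeff a g + coeff c g
    ≡⟨ coeff-++ a c g ⟨
  coeff (a ++ c) g
    ∎
  where
  open ≡-Reasoning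
  open +-*-Solver

module _ (D : ∀ {n} → Gen (suc n) → FS n) (φ : ∀ {n} → Gen n → Gen (suc n))
         (φ-IsZero : ∀ {n} {x : FS n} → IsZero x → IsZero (map (map₂ φ) x)) where

  private
    h : ∀ {n} → FS n → FS (suc n)
    h = map (map₂ φ)

    defect : ∀ {n} → Gen (suc n) → FS (suc n)
    defect g = D (φ g) ++ (h (D g) ++ (- 1ℚ) • g)

    dh+hd≈ : ∀ {n} (x : FS (suc n)) → linear D (h x) ++ (h (linear D x) − x) ≈ linear defect x
    dh+hd≈ {n} x = begin
      linear D (h x) ++ (h (linear D x) ++ scale (- 1ℚ) x)
        ≡⟨ cong₂ (λ dhx hdx → dhx ++ (hdx ++ scale (- 1ℚ) x)) (linear-map₂ D φ x) (map₂-linear φ D x) ⟩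
      linear (D ∘ φ) x ++ (linear (h ∘ D) x ++ scale (- 1ℚ) x)
        ≡⟨ cong (λ y → linear (D ∘ φ) x ++ (linear (h ∘ D) x ++ y)) (scale-linear (- 1ℚ) x) ⟩
      linear (D ∘ φ) x ++ (linear (h ∘ D) x ++ linear ((- 1ℚ) •_) x)
        ≈⟨ ++-cong (≈-refl {x = linear (D ∘ φ) x}) (linear-merge (h ∘ D) ((- 1ℚ) •_) x) ⟩
      linear (D ∘ φ) x ++ linear (λ g → h (D g) ++ (- 1ℚ) • g) x
        ≈⟨ linear-merge (D ∘ φ) (λ g → h (D g) ++ (- 1ℚ) • g) x ⟩
      linear defect x
        ∎
      where open SetoidReasoning (≈-setoid (suc n))

  acyclic-by-homotopy :
    (∀ (g : Gen 0) → IsZero (D (φ g) ++ (- 1ℚ) • g)) → (∀ {n} (g : Gen (suc n)) → IsZero (defect g)) →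
    Acyclic (linear D)
  acyclic-by-homotopy base step zero x _ = h x , IsZero-resp dh≈ (IsZero-linear base x)
    where
    dh≈ : linear (λ g → D (φ g) ++ (- 1ℚ) • g) x ≈ linear D (h x) − x
    dh≈ = begin
      linear (λ g → D (φ g) ++ (- 1ℚ) • g) x
        ≈⟨ linear-merge (D ∘ φ) ((- 1ℚ) •_) x ⟨
      linear (D ∘ φ) x ++ linear ((- 1ℚ) •_) x
        ≡⟨ cong₂ _++_ (linear-map₂ D φ x) (scale-linear (- 1ℚ) x) ⟨
      linear D (h x) ++ scale (- 1ℚ) x
        ∎
      where open SetoidReasoning (≈-setoid 0)
  acyclic-by-homotopy base step (suc n) x dx-zero =
    h x , IsZero-resp dh≈ (IsZero-++ {x = linear defect x} (IsZero-linear step x)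
                                     (IsZero-scale (- 1ℚ) {h (linear D x)} (φ-IsZero {x = linear D x} dx-zero)))
    where
    dh≈ : linear defect x ++ scale (- 1ℚ) (h (linear D x)) ≈ linear D (h x) − x
    dh≈ = ≈-trans (++-cong (≈-sym (dh+hd≈ x)) ≈-refl) (cancel-middle (linear D (h x)) (h (linear D x)) _)

-- Signs of permutations

countᵇ-++ : ∀ {A : Set} (p : A → Bool) xs ys → countᵇ p (xs ++ ys) ≡ countᵇ p xs ℕ.+ countᵇ p ys
countᵇ-++ p []       ys = refl
countᵇ-++ p (x ∷ xs) ys with p x
... | true  = cong suc (countᵇ-++ p xs ys)
... | false = countᵇ-++ p xs ys

countᵇ-map : ∀ {A B : Set} (p : B → Bool) (f : A → B) xs → countᵇ p (map f xs) ≡ countᵇ (p ∘ f) xs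
countᵇ-map p f []       = refl
countᵇ-map p f (x ∷ xs) with p (f x)
... | true  = cong suc (countᵇ-map p f xs)
... | false = countᵇ-map p f xs

countᵇ-tabulate : ∀ {A : Set} {n} (p : A → Bool) (f : Fin n → A) →
                  countᵇ p (L.tabulate f) ≡ countᵇ (p ∘ f) (allFin n)
countᵇ-tabulate p f = trans (cong (countᵇ p) (sym (map-tabulate id f))) (countᵇ-map p f (allFin _))

countᵇ-none : ∀ {A : Set} {p : A → Bool} → (∀ x → p x ≡ false) → ∀ xs → countᵇ p xs ≡ 0
countᵇ-none p≡false []       = refl
countᵇ-none {p = p} p≡false (x ∷ xs) with p x | p≡false x
... | false | _ = countᵇ-none p≡false xs

countᵇ-concatMap : ∀ {A B C : Set} {p : B → Bool} {q : C → Bool} (f : A → List B) (g : A → List C) →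
                   (∀ x → countᵇ p (f x) ≡ countᵇ q (g x)) → ∀ xs →
                   countᵇ p (concatMap f xs) ≡ countᵇ q (concatMap g xs)
countᵇ-concatMap             f g f≡g []       = refl
countᵇ-concatMap {p = p} {q} f g f≡g (x ∷ xs) = begin
  countᵇ p (f x ++ concatMap f xs)
    ≡⟨ countᵇ-++ p (f x) _ ⟩
  countᵇ p (f x) ℕ.+ countᵇ p (concatMap f xs)
    ≡⟨ cong₂ ℕ._+_ (f≡g x) (countᵇ-concatMap f g f≡g xs) ⟩
  countᵇ q (g x) ℕ.+ countᵇ q (concatMap g xs)
    ≡⟨ countᵇ-++ q (g x) _ ⟨
  countᵇ q (g x ++ concatMap g xs)
    ∎
  where open ≡-Reasoning

module _ {n} (σ : Permutation′ n) where

  private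
    τ = lift₀ σ

    isInversion : ∀ {m} → Permutation′ m → Fin m × Fin m → Bool
    isInversion π (i , j) = does (i <? j) ∧ does ((π ⟨$⟩ʳ j) <? (π ⟨$⟩ʳ i))

    row : ∀ {m} → Fin m → List (Fin m × Fin m)
    row {m} i = map (i ,_) (allFin m)

    first-row : countᵇ (isInversion τ) (row zero) ≡ 0
    first-row = trans (countᵇ-map (isInversion τ) (zero ,_) (allFin (suc n)))
                      (countᵇ-none {p = isInversion τ ∘ (zero ,_)} (λ { zero → refl ; (suc j) → refl })
                                   (allFin (suc n)))

    later-row : ∀ i → countᵇ (isInversion τ) (row (suc i)) ≡ countᵇ (isInversion σ) (row i)
    later-row i = begin
      countᵇ (isInversion τ) (row (suc i))
        ≡⟨ countᵇ-map (isInversion τ) (suc i ,_) (allFin (suc n)) ⟩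
      countᵇ (isInversion τ ∘ (suc i ,_)) (zero ∷ L.tabulate suc)
        ≡⟨ countᵇ-tabulate (isInversion τ ∘ (suc i ,_)) suc ⟩
      countᵇ (isInversion σ ∘ (i ,_)) (allFin n)
        ≡⟨ countᵇ-map (isInversion σ) (i ,_) (allFin n) ⟨
      countᵇ (isInversion σ) (row i)
        ∎
      where open ≡-Reasoning

  inversions-lift₀ : inversions (lift₀ σ) ≡ inversions σ
  inversions-lift₀ = begin
    countᵇ (isInversion τ) (row zero ++ concatMap row (L.tabulate suc))
      ≡⟨ countᵇ-++ (isInversion τ) (row zero) _ ⟩
    countᵇ (isInversion τ) (row zero) ℕ.+ countᵇ (isInversion τ) (concatMap row (L.tabulate suc))
      ≡⟨ cong₂ ℕ._+_ first-row (cong (countᵇ (isInversion τ) ∘ concatMap row) (sym (map-tabulate id suc))) ⟩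
    countᵇ (isInversion τ) (concatMap row (map suc (allFin n)))
      ≡⟨ cong (countᵇ (isInversion τ)) (concatMap-map row suc (allFin n)) ⟩
    countᵇ (isInversion τ) (concatMap (row ∘ suc) (allFin n))
      ≡⟨ countᵇ-concatMap (row ∘ suc) row later-row (allFin n) ⟩
    countᵇ (isInversion σ) (concatMap row (allFin n))
      ∎
    where open ≡-Reasoning

sgn-lift₀ : ∀ {n} (σ : Permutation′ n) → sgn (lift₀ σ) ≡ sgn σ
sgn-lift₀ σ = cong parity (inversions-lift₀ σ)

parity-suc-* : ∀ k s → parity (suc k) *ˢ s ≡ Sign.opposite (parity k *ˢ s)
parity-suc-* zero          s = refl
parity-suc-* (suc zero)    s = sym (opposite-involutive s)
parity-suc-* (suc (suc k)) s = parity-suc-* k s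

-- Adjoining on 𝓜

adjoin-cong : ∀ {n} κ {I J : IndepSystem n} → (∀ S → I S ≡ J S) → ∀ S → adjoin κ I S ≡ adjoin κ J S
adjoin-cong κ I≗J (false ∷ S) = I≗J S
adjoin-cong κ I≗J (true ∷ S)  = cong (κ ∧_) (I≗J S)

module Adjoin (κ : Bool) where

  adjoinG : ∀ {n} → Gen n → Gen (suc n)
  adjoinG (M , s) = adjoinM κ M , s

  adjoinF : ∀ {n} → FS n → FS (suc n)
  adjoinF = map (map₂ adjoinG)

  isAdjoined : ∀ {n} → IndepSystem (suc n) → Bool
  isAdjoined {n} I = all (λ S → I (true ∷ S) == (κ ∧ I (false ∷ S))) (allSubsets n)

  T-isAdjoined : ∀ {n} {I : IndepSystem (suc n)} → T (isAdjoined I) ⇔ (∀ S → adjoin κ (deleteZero I) S ≡ I S)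
  T-isAdjoined = mk⇔
    (λ t → λ { (false ∷ S) → refl ; (true ∷ S) → sym (to T-== (to T-all-allSubsets t S)) })
    (λ I≗ → from T-all-allSubsets λ S → from T-== (sym (I≗ (true ∷ S))))

  genEq-adjoinG : ∀ {n} (g : Gen n) N t →
                  genEq (adjoinG g) (N , t) ≡ isAdjoined (indep N) ∧ genEq g (deleteZeroM N , t)
  genEq-adjoinG (M , s) N t = T-injective
    (λ e → let (adj , M≅N⁻) = sound (to (T-genEq {g = adjoinG (M , s)} {N , t}) e)
           in from T-∧ (adj , from T-genEq M≅N⁻))
    (λ e → let (adj , M≅N⁻) = to (T-∧ {isAdjoined (indep N)}) e
           in from T-genEq (complete adj (to (T-genEq {g = M , s} {deleteZeroM N , t}) M≅N⁻)))
    where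
    sound : adjoinG (M , s) ≅ (N , t) → T (isAdjoined (indep N)) × (M , s) ≅ (deleteZeroM N , t)
    sound (s≡t , M⁺≗N) =
      from T-isAdjoined (λ S → trans (adjoin-cong κ (λ S′ → sym (M⁺≗N (false ∷ S′))) S) (M⁺≗N S)) ,
      (s≡t , λ S → M⁺≗N (false ∷ S))
    complete : T (isAdjoined (indep N)) → (M , s) ≅ (deleteZeroM N , t) → adjoinG (M , s) ≅ (N , t)
    complete adj (s≡t , M≗N⁻) = s≡t , λ S → trans (adjoin-cong κ M≗N⁻ S) (to (T-isAdjoined {I = indep N}) adj S)

  coeff-adjoinF : ∀ {n} (x : FS n) N t →
                  coeff (adjoinF x) (N , t) ≡ (if isAdjoined (indep N) then coeff x (deleteZeroM N , t) else 0ℚ)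
  coeff-adjoinF []            N t with isAdjoined (indep N)
  ... | true  = refl
  ... | false = refl
  coeff-adjoinF ((q , g) ∷ x) N t rewrite genEq-adjoinG g N t | coeff-adjoinF x N t
    with isAdjoined (indep N)
  ... | true  = refl
  ... | false = refl

  adjoinF-resp-≈ : ∀ {n} {x y : FS n} → x ≈ y → adjoinF x ≈ adjoinF y
  adjoinF-resp-≈ {x = x} {y} x≈y = mk≈ λ (N , t) →
    trans (coeff-adjoinF x N t)
          (trans (cong (λ c → if isAdjoined (indep N) then c else 0ℚ) (coeff≡ x≈y (deleteZeroM N , t)))
                 (sym (coeff-adjoinF y N t)))

  adjoinM-iso : ∀ {n} {M M′ : Matroid n} {σ} → IsIso σ M M′ → IsIso (lift₀ σ) (adjoinM κ M) (adjoinM κ M′)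
  adjoinM-iso σ-iso (false ∷ S) = σ-iso S
  adjoinM-iso σ-iso (true ∷ S)  = cong (κ ∧_) (σ-iso S)

  adjoinR : ∀ {n} → Rel n → Rel (suc n)
  adjoinR (antisym g)       = antisym (adjoinG g)
  adjoinR (iso M M′ σ ι s) = iso (adjoinM κ M) (adjoinM κ M′) (lift₀ σ) (adjoinM-iso {M = M} {M′} {σ} ι) s

  adjoinF-relElem : ∀ {n} (r : Rel n) → adjoinF (relElem r) ≡ relElem (adjoinR r)
  adjoinF-relElem (antisym g)       = refl
  adjoinF-relElem (iso M M′ σ ι s) =
    cong (λ ε → (1ℚ , adjoinG (M , s)) ∷ (- 1ℚ , (adjoinM κ M′ , ε *ˢ s)) ∷ []) (sym (sgn-lift₀ σ))

  adjoinF-IsZero : ∀ {n} {x : FS n} → IsZero x → IsZero (adjoinF x)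
  adjoinF-IsZero {x = x} (rs , x≈rs) = map (map₂ adjoinR) rs , coeff≡ (begin
    adjoinF x                                  ≈⟨ adjoinF-resp-≈ (mk≈ {x = x} {linear relElem rs} x≈rs) ⟩
    adjoinF (linear relElem rs)                ≡⟨ map₂-linear adjoinG relElem rs ⟩
    linear (adjoinF ∘ relElem) rs              ≡⟨ linear-cong adjoinF-relElem rs ⟩
    linear (relElem ∘ adjoinR) rs              ≡⟨ linear-map₂ relElem adjoinR rs ⟨
    linear relElem (map (map₂ adjoinR) rs)     ∎)
    where open SetoidReasoning (≈-setoid _)

-- The differentials

minorTerm : ∀ {n} → Bool → Maybe′ (Matroid n) → Sign → FS n
minorTerm true  (just M) s = 1ℚ • (M , s)
minorTerm true  nothing  s = []
minorTerm false _        s = []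

minorTerm-just : ∀ {n} {I : IndepSystem n} (M : Matroid n) s → (∀ S → I S ≡ indep M S) →
                 minorTerm true (toMatroid I) s ≈ 1ℚ • (M , s)
minorTerm-just {I = I} M s I≗M =
  ≈-trans (≡⇒≈ (cong (λ m → minorTerm true m s) (toMatroid-just (isMatroid-resp (sym ∘ I≗M) (proj₂ M)))))
          (•-resp-≅ 1ℚ (refl , I≗M))

minorTerm-nothing : ∀ {n} {I : IndepSystem n} {s} → ¬ T (isMatroid I) → minorTerm true (toMatroid I) s ≡ []
minorTerm-nothing {s = s} ¬p = cong (λ m → minorTerm true m s) (toMatroid-nothing ¬p)

module _ (minor : Minor) (keep : ∀ {n} → Matroid (suc n) → Fin (suc n) → Bool) where

  face : ∀ {n} → Matroid (suc n) → Sign → Fin (suc n) → FS n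
  face M s x = minorTerm (keep M x) (toMatroid (minor M x)) (parity (toℕ x) *ˢ s)

  mutual
    dGen-faces : ∀ {n} (M : Matroid (suc n)) s → dGen minor keep (M , s) ≡ concatMap (face M s) (allFin (suc n))
    dGen-faces M s = concatMap-cong (term≡face M s) (allFin _)

    -- the left-hand side is the local function of dGen's where-block, which cannot be named here
    term≡face : ∀ {n} (M : Matroid (suc n)) s (x : Fin (suc n)) → _ ≡ face M s x
    term≡face M s x with keep M x | toMatroid (minor M x)
    ... | true  | just _  = refl
    ... | true  | nothing = refl
    ... | false | _       = refl

record AdjoinCompatible (minor : Minor) (keep : ∀ {n} → Matroid (suc n) → Fin (suc n) → Bool) (κ : Bool) : Set where
  field
    keep-zero  : ∀ {n} (M : Matroid n) → keep (adjoinM κ M) zero ≡ true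
    keep-suc   : ∀ {n} (M : Matroid (suc n)) x → keep (adjoinM κ M) (suc x) ≡ keep M x
    minor-zero : ∀ {n} (M : Matroid n) S → minor (adjoinM κ M) zero S ≡ indep M S
    minor-suc  : ∀ {n} (M : Matroid (suc n)) x S → minor (adjoinM κ M) (suc x) S ≡ adjoin κ (minor M x) S

module _ {minor : Minor} {keep : ∀ {n} → Matroid (suc n) → Fin (suc n) → Bool} {κ : Bool}
         (compatible : AdjoinCompatible minor keep κ) where

  open AdjoinCompatible compatible
  open Adjoin κ

  private
    D : ∀ {n} → Gen (suc n) → FS n
    D = dGen minor keep

    adjoinedFaces : ∀ {n} → Matroid n → Sign → FS n
    adjoinedFaces {n} M s = concatMap (face minor keep (adjoinM κ M) s ∘ suc) (allFin n)

  dGen-adjoinG : ∀ {n} (M : Matroid n) s → D (adjoinG (M , s)) ≈ 1ℚ • (M , s) ++ adjoinedFaces M s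
  dGen-adjoinG {n} M s = begin
    D (adjoinG (M , s))
      ≡⟨ dGen-faces minor keep (adjoinM κ M) s ⟩
    F zero ++ concatMap F (L.tabulate suc)
      ≡⟨ cong (λ xs → F zero ++ concatMap F xs) (sym (map-tabulate id suc)) ⟩
    F zero ++ concatMap F (map suc (allFin n))
      ≡⟨ cong (F zero ++_) (concatMap-map F suc (allFin n)) ⟩
    F zero ++ adjoinedFaces M s
      ≈⟨ ++-cong (zero-face) ≈-refl ⟩
    1ℚ • (M , s) ++ adjoinedFaces M s
      ∎
    where
    open SetoidReasoning (≈-setoid n)
    F = face minor keep (adjoinM κ M) s
    zero-face : F zero ≈ 1ℚ • (M , s)
    zero-face rewrite keep-zero M = minorTerm-just M s (minor-zero M)

  face-suc-cancels : ∀ {n} (M : Matroid (suc n)) s x →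
                     IsZero (face minor keep (adjoinM κ M) s (suc x) ++ adjoinF (face minor keep M s x))
  face-suc-cancels M s x rewrite keep-suc M x with keep M x
  ... | false = IsZero-[]
  ... | true  = by-cases (T? (isMatroid (minor M x)))
    where
    t  = parity (toℕ x) *ˢ s
    new = minorTerm true (toMatroid (minor (adjoinM κ M) (suc x))) (parity (toℕ (suc x)) *ˢ s)
    old = minorTerm true (toMatroid (minor M x)) t
    by-cases : Dec (T (isMatroid (minor M x))) → IsZero (new ++ adjoinF old)
    by-cases (no ¬p) = IsZero-resp (≡⇒≈ (sym both-empty)) IsZero-[]
      where
      new¬p : ¬ T (isMatroid (minor (adjoinM κ M) (suc x)))
      new¬p = ¬p ∘ isMatroid-deleteZero {I = adjoin κ (minor M x)}
                 ∘ isMatroid-resp {I = minor (adjoinM κ M) (suc x)} (minor-suc M x)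
      both-empty : new ++ adjoinF old ≡ []
      both-empty = cong₂ _++_ (minorTerm-nothing {I = minor (adjoinM κ M) (suc x)} new¬p)
                              (cong adjoinF (minorTerm-nothing {I = minor M x} ¬p))
    by-cases (yes p) = IsZero-resp (≈-sym faces≈) (IsZero-relElem (antisym (adjoinG (Mₓ , t))))
      where
      Mₓ = (minor M x , p)
      old≈ : old ≈ 1ℚ • (Mₓ , t)
      old≈ = minorTerm-just Mₓ t (λ _ → refl)
      new≈ : new ≈ 1ℚ • (adjoinM κ Mₓ , Sign.opposite t)
      new≈ rewrite parity-suc-* (toℕ x) s = minorTerm-just (adjoinM κ Mₓ) _ (minor-suc M x)
      faces≈ : new ++ adjoinF old ≈ relElem (antisym (adjoinG (Mₓ , t)))
      faces≈ = ≈-trans (++-cong new≈ (adjoinF-resp-≈ old≈))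
                       (++-comm (1ℚ • (adjoinM κ Mₓ , Sign.opposite t)) (1ℚ • adjoinG (Mₓ , t)))

  adjoinedFaces-cancel : ∀ {n} (M : Matroid (suc n)) s → IsZero (adjoinedFaces M s ++ adjoinF (D (M , s)))
  adjoinedFaces-cancel {n} M s =
    IsZero-resp (≈-sym faces≈)
                (IsZero-concatMap {f = λ x → F⁺ x ++ adjoinF (F x)} (face-suc-cancels M s) (allFin (suc n)))
    where
    open SetoidReasoning (≈-setoid (suc n))
    F⁺ = face minor keep (adjoinM κ M) s ∘ suc
    F  = face minor keep M s
    faces≈ : adjoinedFaces M s ++ adjoinF (D (M , s)) ≈ concatMap (λ x → F⁺ x ++ adjoinF (F x)) (allFin (suc n))
    faces≈ = begin
      adjoinedFaces M s ++ adjoinF (D (M , s))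
        ≡⟨ cong (λ d → adjoinedFaces M s ++ adjoinF d) (dGen-faces minor keep M s) ⟩
      adjoinedFaces M s ++ adjoinF (concatMap F (allFin (suc n)))
        ≡⟨ cong (adjoinedFaces M s ++_) (map-concatMap (map₂ adjoinG) F (allFin (suc n))) ⟩
      adjoinedFaces M s ++ concatMap (adjoinF ∘ F) (allFin (suc n))
        ≈⟨ concatMap-merge F⁺ (adjoinF ∘ F) (allFin (suc n)) ⟩
      concatMap (λ x → F⁺ x ++ adjoinF (F x)) (allFin (suc n))
        ∎

  homotopy-base : ∀ (g : Gen 0) → IsZero (D (adjoinG g) ++ (- 1ℚ) • g)
  homotopy-base (M , s) = IsZero-resp (≈-sym dh≈) IsZero-[]
    where
    open SetoidReasoning (≈-setoid 0)
    dh≈ : D (adjoinG (M , s)) ++ (- 1ℚ) • (M , s) ≈ []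
    dh≈ = begin
      D (adjoinG (M , s)) ++ (- 1ℚ) • (M , s)
        ≈⟨ ++-cong (dGen-adjoinG M s) ≈-refl ⟩
      (1ℚ • (M , s) ++ []) ++ (- 1ℚ) • (M , s)
        ≡⟨ cong (_++ (- 1ℚ) • (M , s)) (++-identityʳ (1ℚ • (M , s))) ⟩
      1ℚ • (M , s) ++ (- 1ℚ) • (M , s)
        ≈⟨ •-cancel (M , s) ⟩
      []
        ∎

  homotopy-step : ∀ {n} (g : Gen (suc n)) → IsZero (D (adjoinG g) ++ (adjoinF (D g) ++ (- 1ℚ) • g))
  homotopy-step {n} (M , s) =
    IsZero-resp (≈-sym dh+hd≈)
      (IsZero-++ {x = adjoinedFaces M s ++ adjoinF (D g)} (adjoinedFaces-cancel M s)
                 (IsZero-resp (≈-sym (•-cancel g)) IsZero-[]))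
    where
    open SetoidReasoning (≈-setoid (suc n))
    g = (M , s)
    dh+hd≈ : D (adjoinG g) ++ (adjoinF (D g) ++ (- 1ℚ) • g)
             ≈ (adjoinedFaces M s ++ adjoinF (D g)) ++ (1ℚ • g ++ (- 1ℚ) • g)
    dh+hd≈ = begin
      D (adjoinG g) ++ (adjoinF (D g) ++ (- 1ℚ) • g)
        ≈⟨ ++-cong (dGen-adjoinG M s) ≈-refl ⟩
      (1ℚ • g ++ adjoinedFaces M s) ++ (adjoinF (D g) ++ (- 1ℚ) • g)
        ≈⟨ ++-cong (++-comm (1ℚ • g) (adjoinedFaces M s)) ≈-refl ⟩
      (adjoinedFaces M s ++ 1ℚ • g) ++ (adjoinF (D g) ++ (- 1ℚ) • g)
        ≈⟨ ++-interchange (adjoinedFaces M s) _ _ _ ⟩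
      (adjoinedFaces M s ++ adjoinF (D g)) ++ (1ℚ • g ++ (- 1ℚ) • g)
        ∎

  acyclic : Acyclic (diff minor keep)
  acyclic = acyclic-by-homotopy D adjoinG (λ {n} {x} → adjoinF-IsZero {n} {x}) homotopy-base homotopy-step

-- Deletion and contraction

all-tabulate : ∀ {A : Set} {n} (p : A → Bool) (f : Fin n → A) → all p (L.tabulate f) ≡ all (p ∘ f) (allFin n)
all-tabulate p f = cong and (trans (map-tabulate f p) (sym (map-tabulate id (p ∘ f))))

card-≔-true : ∀ {n} (B : Subset n) y → T (not (lookup B y)) → card (B [ y ]≔ true) ≡ suc (card B)
card-≔-true (false ∷ B) zero    _   = refl
card-≔-true (true ∷ B)  (suc y) ¬By = cong suc (card-≔-true B y ¬By)
card-≔-true (false ∷ B) (suc y) ¬By = card-≔-true B y ¬By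

card-≤ : ∀ {n} (B : Subset n) → card B ℕ.≤ n
card-≤ []          = ℕ.z≤n
card-≤ (true ∷ B)  = ℕ.s≤s (card-≤ B)
card-≤ (false ∷ B) = ℕ.m≤n⇒m≤1+n (card-≤ B)

card-< : ∀ {n} (B : Subset n) y → T (not (lookup B y)) → card B ℕ.< n
card-< (false ∷ B) zero    _   = ℕ.s≤s (card-≤ B)
card-< (true ∷ B)  (suc y) ¬By = ℕ.s≤s (card-< B y ¬By)
card-< (false ∷ B) (suc y) ¬By = ℕ.m<n⇒m<1+n (card-< B y ¬By)

basis-exists : ∀ {n} (M : Matroid n) → ∃ λ B → T (isBasis M B)
basis-exists {n} M = grow n emptySet (IsMatroid.indep-∅ (IsMatroid-indep M)) (ℕ.m≤n+m n _)
  where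
  I = indep M
  saturated : Subset n → Fin n → Bool
  saturated B y = lookup B y ∨ not (I (B [ y ]≔ true))
  unsaturated : ∀ {B y} → ¬ T (saturated B y) → T (not (lookup B y)) × T (I (B [ y ]≔ true))
  unsaturated {B} {y} ¬sat with lookup B y | I (B [ y ]≔ true)
  ... | false | true  = tt , tt
  ... | true  | _     = ⊥-elim (¬sat tt)
  ... | false | false = ⊥-elim (¬sat tt)
  grow : ∀ k B → T (I B) → n ℕ.≤ card B ℕ.+ k → ∃ λ B → T (isBasis M B)
  grow k B iB n≤ with T? (all (saturated B) (allFin n))
  ... | yes sat = B , from T-∧ (iB , sat)
  ... | no ¬sat with ¬∀⟶∃¬ n _ (λ y → T? (saturated B y)) (¬sat ∘ from T-all-allFin)
  ... | y , ¬saty with unsaturated {B} {y} ¬saty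
  grow zero    B iB n≤ | no _ | y , _ | ¬By , _ =
    ⊥-elim (ℕ.<⇒≱ (card-< B y ¬By) (subst (n ℕ.≤_) (ℕ.+-identityʳ (card B)) n≤))
  grow (suc k) B iB n≤ | no _ | y , _ | ¬By , iBy =
    grow k (B [ y ]≔ true) iBy
         (subst (n ℕ.≤_) (trans (ℕ.+-suc (card B) k) (cong (ℕ._+ k) (sym (card-≔-true B y ¬By)))) n≤)

isBasis-adjoin-loop : ∀ {n} (M : Matroid n) B → isBasis (adjoinM false M) (false ∷ B) ≡ isBasis M B
isBasis-adjoin-loop M B = cong (indep M B ∧_) (all-tabulate maximal-at suc)
  where
  maximal-at : Fin (suc _) → Bool
  maximal-at y = lookup (false ∷ B) y ∨ not (indep (adjoinM false M) ((false ∷ B) [ y ]≔ true))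

isColoop-adjoin-loop-zero : ∀ {n} (M : Matroid n) → isColoop (adjoinM false M) zero ≡ false
isColoop-adjoin-loop-zero M = T-injective
  (λ coloop → let (B , basis) = basis-exists M in
              to T-⇒ᵇ (to T-all-allSubsets coloop (false ∷ B)) (subst T (sym (isBasis-adjoin-loop M B)) basis))
  (λ ())

isColoop-adjoin-loop-suc : ∀ {n} (M : Matroid (suc n)) x → isColoop (adjoinM false M) (suc x) ≡ isColoop M x
isColoop-adjoin-loop-suc M x = T-injective
  (λ coloop → from T-all-allSubsets λ B → from T-⇒ᵇ λ basis →
     to T-⇒ᵇ (to T-all-allSubsets coloop (false ∷ B)) (subst T (sym (isBasis-adjoin-loop M B)) basis))
  (λ coloop → from (T-all-allSubsets {p = λ B → isBasis (adjoinM false M) B ⇒ᵇ lookup B (suc x)}) λ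
     { (false ∷ B) → from T-⇒ᵇ λ basis →
         to T-⇒ᵇ (to T-all-allSubsets coloop B) (subst T (isBasis-adjoin-loop M B) basis)
     ; (true ∷ B) → from (T-⇒ᵇ {isBasis (adjoinM false M) (true ∷ B)} {lookup B x}) λ () })

⊥≡emptySet : ∀ {n} → ⊥ {n} ≡ emptySet
⊥≡emptySet {zero}  = refl
⊥≡emptySet {suc n} = cong (false ∷_) ⊥≡emptySet

isLoop-adjoin-coloop-zero : ∀ {n} (M : Matroid n) → isLoop (adjoinM true M) zero ≡ false
isLoop-adjoin-coloop-zero M =
  cong not (trans (cong (indep M) ⊥≡emptySet) (to T-≡ (IsMatroid.indep-∅ (IsMatroid-indep M))))

deleteRaw-adjoin-suc : ∀ κ {n} (M : Matroid (suc n)) x S →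
                       deleteRaw (adjoinM κ M) (suc x) S ≡ adjoin κ (deleteRaw M x) S
deleteRaw-adjoin-suc κ M x (false ∷ S) = refl
deleteRaw-adjoin-suc κ M x (true ∷ S)  = refl

contractRaw-adjoin-zero : ∀ {n} (M : Matroid n) S → contractRaw (adjoinM true M) zero S ≡ indep M S
contractRaw-adjoin-zero M S rewrite isLoop-adjoin-coloop-zero M = refl

contractRaw-adjoin-suc : ∀ {n} (M : Matroid (suc n)) x S →
                         contractRaw (adjoinM true M) (suc x) S ≡ adjoin true (contractRaw M x) S
contractRaw-adjoin-suc M x (false ∷ S) = refl
contractRaw-adjoin-suc M x (true ∷ S)  = refl

deletion-compatible : AdjoinCompatible deleteRaw (λ M x → not (isColoop M x)) false
deletion-compatible = record
  { keep-zero  = λ M → cong not (isColoop-adjoin-loop-zero M)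
  ; keep-suc   = λ M x → cong not (isColoop-adjoin-loop-suc M x)
  ; minor-zero = λ M S → refl
  ; minor-suc  = deleteRaw-adjoin-suc false
  }

total-deletion-compatible : AdjoinCompatible deleteRaw (λ _ _ → true) false
total-deletion-compatible = record
  { keep-zero  = λ M → refl
  ; keep-suc   = λ M x → refl
  ; minor-zero = λ M S → refl
  ; minor-suc  = deleteRaw-adjoin-suc false
  }

contraction-compatible : AdjoinCompatible contractRaw (λ M x → not (isLoop M x)) true
contraction-compatible = record
  { keep-zero  = λ M → cong not (isLoop-adjoin-coloop-zero M)
  ; keep-suc   = λ M x → refl
  ; minor-zero = contractRaw-adjoin-zero
  ; minor-suc  = contractRaw-adjoin-suc
  }

total-contraction-compatible : AdjoinCompatible contractRaw (λ _ _ → true) true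
total-contraction-compatible = record
  { keep-zero  = λ M → refl
  ; keep-suc   = λ M x → refl
  ; minor-zero = contractRaw-adjoin-zero
  ; minor-suc  = contractRaw-adjoin-suc
  }

theorem5p13 : Acyclic ∂del × Acyclic ∂totdel × Acyclic ∂con × Acyclic ∂totcon
theorem5p13 =
  acyclic deletion-compatible , acyclic total-deletion-compatible ,
  acyclic contraction-compatible , acyclic total-contraction-compatible
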